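{- Let $b\ge 2$ with $b\not\equiv 1\pmod 3$, and let $n\ge 2$. Then $$g(T_{b'}(n)) = 3b + \frac{b^{2n}(b^3+b^2-b-1) + b^{n}\{b^2(n+1)-(n+3)\}}{2}.$$
   Context: For integers $b\ge2$ with $b\not\equiv1\pmod3$, $n\ge0$, $i\ge0$ put $s'_i=(b+1)b^{n+i}+1$, and $T_{b'}(n)=\langle\{s'_i:i\in\mathbb{N}\}\rangle$ (submonoid of $(\mathbb{N},+)$ generated by them, a numerical semigroup). The genus $g(S)$ is the cardinality of $\mathbb{N}\setminus S$. -}

module Defs where

open import Data.Fin.Base using (Fin)
open import Data.Nat.Base using (ℕ; _+_; _*_; _^_)
open import Data.Product.Base using (Σ-syntax; ∃-syntax; _×_)
open import Function.Bundles using (_⇔_)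
open import Function.Definitions using (Injective)
open import Level using (Level)
open import Relation.Binary.PropositionalEquality.Core using (_≡_)
open import Relation.Unary using (Pred; _∈_; ∁)

private
  variable
    ℓ : Level

data ⟨_⟩ (G : Pred ℕ ℓ) : Pred ℕ ℓ where
  gen  : ∀ {x} → x ∈ G → x ∈ ⟨ G ⟩
  zero : 0 ∈ ⟨ G ⟩
  plus : ∀ {x y} → x ∈ ⟨ G ⟩ → y ∈ ⟨ G ⟩ → x + y ∈ ⟨ G ⟩

s′ : (b n i : ℕ) → ℕ
s′ b n i = (b + 1) * b ^ (n + i) + 1

T′ : (b n : ℕ) → Pred ℕ _
T′ b n = ⟨ (λ x → ∃[ i ] x ≡ s′ b n i) ⟩

-- A bijection from Fin k onto the set P.  It is phrased with the underlying
-- numbers rather than with Fin k ⤖ ∃ P, because elements of ∃ P also carry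
-- membership proofs, which need not be unique.
HasCardinality : Pred ℕ ℓ → ℕ → Set ℓ
HasCardinality P k =
  Σ[ e ∈ (Fin k → ℕ) ] (Injective _≡_ _≡_ e × (∀ x → x ∈ P ⇔ (∃[ i ] e i ≡ x)))

-- "S has finite complement and g(S) = g".
HasGenus : Pred ℕ ℓ → ℕ → Set ℓ
HasGenus S g = HasCardinality (∁ S) g

{-# OPTIONS --safe #-}
-- Put a = b - 1, M = (b + 1) bⁿ and m = M + 1, the smallest generator.  Since
-- s′ᵢ = M bⁱ + 1, a sum of k generators whose powers bⁱ add up to V equals
-- M V + k = m V - (V - k), and the possible V - k are the numbers a c with
-- c ≤ L V = ∑_{j≥1} ⌊V / bʲ⌋ (each c counts the carries b bⁱ → bⁱ⁺¹).  Hence the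
-- least element of the semigroup in the class of - a c modulo m is
-- m b W(c) - a c for 0 ≤ c ≤ M, with W(c) the least W such that
-- F W = ∑_{j≥0} ⌊W / bʲ⌋ ≥ c; these classes are all distinct because b ≢ 1
-- (mod 3) makes a prime to m.  Selmer's formula gives g = b (∑ W(c) - M / 2), and
-- ∑ W(c) = ∑ (M - F W) over the W with F W < M.  For n ≥ 2 these are the W ≤ K + 1
-- with K = (b² - 1) bⁿ⁻¹, where F K = M - 2 and F (K + 1) = M - 1; these last two
-- terms contribute the summand 3 b.
module Submission where

open import Defs
open import Data.Nat.Base as ℕ using (ℕ)
open import Data.Nat.DivMod using (_%_)
open import Data.Product.Base using (∃-syntax; _×_; _,_; proj₁; proj₂; map₂)
open import Function.Base using (_∘_; id)
open import Relation.Binary.PropositionalEquality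

-- The formula is doubled and its negative terms are moved to the left, so that
-- neither division nor subtraction occurs.
DoubledFormula : (g b n : ℕ) → Set
DoubledFormula g b n =
  2 ℕ.* g ℕ.+ (B ℕ.* B ℕ.* (b ℕ.+ 1) ℕ.+ B ℕ.* (n ℕ.+ 3))
    ≡ 6 ℕ.* b ℕ.+ (B ℕ.* B ℕ.* (b ℕ.^ 3 ℕ.+ b ℕ.^ 2) ℕ.+ B ℕ.* (b ℕ.^ 2 ℕ.* (n ℕ.+ 1)))
  where B = b ℕ.^ n

module Naturals where

  open import Data.Fin.Base using (zero; suc)
  open import Data.List.Base using (List; []; _∷_; _++_; length; lookup; applyUpTo)
  open import Data.List.Properties using (length-++; length-applyUpTo)
  open import Data.List.Membership.Propositional using () renaming (_∈_ to _∈ˡ_)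
  open import Data.List.Membership.Propositional.Properties
    using (∈-lookup; ∈-++⁺ˡ; ∈-++⁺ʳ; ∈-++⁻; ∈-applyUpTo⁺; ∈-applyUpTo⁻)
  import Data.List.Relation.Unary.All as All
  open import Data.List.Relation.Unary.AllPairs using ([]; _∷_)
  open import Data.List.Relation.Unary.Any using (index)
  open import Data.List.Relation.Unary.Any.Properties using (lookup-index)
  open import Data.List.Relation.Unary.Unique.Propositional using (Unique)
  open import Data.List.Relation.Unary.Unique.Propositional.Properties using (++⁺; applyUpTo⁺₁)
  open import Data.Nat.Base hiding (ℕ)
  open import Data.Nat.Coprimality using (Coprime; coprime-Bézout)
  open import Data.Nat.DivMod hiding (_%_)
  open import Data.Nat.Divisibility
  open import Data.Nat.GCD using (module Bézout)
  open import Data.Nat.Properties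
  open import Data.Nat.Tactic.RingSolver using (solve-∀)
  open import Data.Sum.Base using (_⊎_; inj₁; inj₂)
  open import Function.Bundles using (_⇔_; mk⇔; Equivalence)
  open import Level using (Level)
  open import Relation.Nullary using (¬_; yes; no; contradiction)
  open import Relation.Unary using (Pred; _∈_; ∁)

  private
    variable
      ℓ : Level

  -- Finite sums

  ∑ : ℕ → (ℕ → ℕ) → ℕ
  ∑ zero    f = 0
  ∑ (suc n) f = ∑ n f + f n

  ∑-cong : ∀ n {f g : ℕ → ℕ} → (∀ {i} → i < n → f i ≡ g i) → ∑ n f ≡ ∑ n g
  ∑-cong zero    f≗g = refl
  ∑-cong (suc n) f≗g = cong₂ _+_ (∑-cong n (f≗g ∘ m<n⇒m<1+n)) (f≗g (n<1+n n))

  ∑-distrib-+ : ∀ n (f g : ℕ → ℕ) → ∑ n (λ i → f i + g i) ≡ ∑ n f + ∑ n g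
  ∑-distrib-+ zero    f g = refl
  ∑-distrib-+ (suc n) f g =
    trans (cong (_+ (f n + g n)) (∑-distrib-+ n f g)) (interchange (∑ n f) (∑ n g) (f n) (g n))
    where
    interchange : ∀ w x y z → (w + x) + (y + z) ≡ (w + y) + (x + z)
    interchange = solve-∀

  *-distribˡ-∑ : ∀ n k (f : ℕ → ℕ) → ∑ n (λ i → k * f i) ≡ k * ∑ n f
  *-distribˡ-∑ zero    k f = sym (*-zeroʳ k)
  *-distribˡ-∑ (suc n) k f =
    trans (cong (_+ k * f n) (*-distribˡ-∑ n k f)) (sym (*-distribˡ-+ k (∑ n f) (f n)))

  ∑-const : ∀ n k → ∑ n (λ _ → k) ≡ n * k
  ∑-const zero    k = refl
  ∑-const (suc n) k = trans (cong (_+ k) (∑-const n k)) (+-comm (n * k) k)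

  ∑-swap : ∀ m n (f : ℕ → ℕ → ℕ) → ∑ m (λ i → ∑ n (f i)) ≡ ∑ n (λ j → ∑ m (λ i → f i j))
  ∑-swap zero    n f = sym (trans (∑-const n 0) (*-zeroʳ n))
  ∑-swap (suc m) n f =
    trans (cong (_+ ∑ n (f m)) (∑-swap m n f)) (sym (∑-distrib-+ n _ (f m)))

  ∑-split : ∀ m n (f : ℕ → ℕ) → ∑ (m + n) f ≡ ∑ m f + ∑ n (λ i → f (m + i))
  ∑-split m zero    f rewrite +-identityʳ m = sym (+-identityʳ (∑ m f))
  ∑-split m (suc n) f rewrite +-suc m n | ∑-split m n f = +-assoc (∑ m f) _ (f (m + n))

  ∑-reverse : ∀ n (f : ℕ → ℕ) → ∑ n f ≡ ∑ n (λ i → f (n ∸ suc i))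
  ∑-reverse zero    f = refl
  ∑-reverse (suc n) f = begin
    ∑ n f + f n                        ≡⟨ +-comm (∑ n f) (f n) ⟩
    f n + ∑ n f                        ≡⟨ cong (f n +_) (∑-reverse n f) ⟩
    f n + ∑ n (λ i → f (n ∸ suc i))    ≡⟨ ∑-split 1 n (λ i → f (n ∸ i)) ⟨
    ∑ (suc n) (λ i → f (suc n ∸ suc i)) ∎
    where open ≡-Reasoning

  -- Gauss's trick: the sum is added to its own reversal and the terms are paired by index.
  ∑-antisymmetric : ∀ n k (f : ℕ → ℕ) → (∀ {i} → i < n → f i + f (n ∸ suc i) ≡ k) →
                    2 * ∑ n f ≡ n * k
  ∑-antisymmetric n k f f+f≡k = begin
    2 * ∑ n f                            ≡⟨ cong (∑ n f +_) (+-identityʳ (∑ n f)) ⟩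
    ∑ n f + ∑ n f                        ≡⟨ cong (∑ n f +_) (∑-reverse n f) ⟩
    ∑ n f + ∑ n (λ i → f (n ∸ suc i))    ≡⟨ ∑-distrib-+ n f _ ⟨
    ∑ n (λ i → f i + f (n ∸ suc i))      ≡⟨ ∑-cong n f+f≡k ⟩
    ∑ n (λ _ → k)                        ≡⟨ ∑-const n k ⟩
    n * k                                ∎
    where open ≡-Reasoning

  ∑-id : ∀ n → 2 * ∑ n id + n ≡ n * n
  ∑-id zero    = refl
  ∑-id (suc n) = begin
    2 * (∑ n id + n) + suc n       ≡⟨ expand (∑ n id) n ⟩
    (2 * ∑ n id + n) + (2 * n + 1) ≡⟨ cong (_+ (2 * n + 1)) (∑-id n) ⟩
    n * n + (2 * n + 1)            ≡⟨ square n ⟩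
    suc n * suc n                  ∎
    where
    open ≡-Reasoning
    expand : ∀ s n → 2 * (s + n) + suc n ≡ (2 * s + n) + (2 * n + 1)
    expand = solve-∀
    square : ∀ n → n * n + (2 * n + 1) ≡ suc n * suc n
    square = solve-∀

  -- Each quotient below n comes from b consecutive indices, so the induction adds one block of
  -- length b at a time.
  ∑-quotients : ∀ b .{{_ : NonZero b}} n (f : ℕ → ℕ) → ∑ (n * b) (λ i → f (i / b)) ≡ b * ∑ n f
  ∑-quotients b zero    f = sym (*-zeroʳ b)
  ∑-quotients b (suc n) f = begin
    ∑ (b + n * b) g                          ≡⟨ cong (λ k → ∑ k g) (+-comm b (n * b)) ⟩
    ∑ (n * b + b) g                          ≡⟨ ∑-split (n * b) b g ⟩
    ∑ (n * b) g + ∑ b (λ i → g (n * b + i))  ≡⟨ cong₂ _+_ (∑-quotients b n f) (∑-cong b (cong f ∘ quotient≡)) ⟩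
    b * ∑ n f + ∑ b (λ _ → f n)              ≡⟨ cong (b * ∑ n f +_) (∑-const b (f n)) ⟩
    b * ∑ n f + b * f n                      ≡⟨ *-distribˡ-+ b (∑ n f) (f n) ⟨
    b * (∑ n f + f n)                        ∎
    where
    open ≡-Reasoning
    g : ℕ → ℕ
    g i = f (i / b)
    quotient≡ : ∀ {i} → i < b → (n * b + i) / b ≡ n
    quotient≡ {i} i<b = begin
      (n * b + i) / b     ≡⟨ +-distrib-/-∣ˡ i (n∣m*n n) ⟩
      n * b / b + i / b   ≡⟨ cong₂ _+_ (m*n/n≡m n b) (m<n⇒m/n≡0 i<b) ⟩
      n + 0               ≡⟨ +-identityʳ n ⟩
      n                   ∎

  -- Threshold counting

  𝟙[_<_] : ℕ → ℕ → ℕ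
  𝟙[ x < zero ]      = 0
  𝟙[ zero < suc c ]  = 1
  𝟙[ suc x < suc c ] = 𝟙[ x < c ]

  𝟙-true : ∀ {x c} → x < c → 𝟙[ x < c ] ≡ 1
  𝟙-true {zero}  (s≤s _)   = refl
  𝟙-true {suc x} (s≤s x<c) = 𝟙-true x<c

  𝟙-false : ∀ {x c} → c ≤ x → 𝟙[ x < c ] ≡ 0
  𝟙-false z≤n       = refl
  𝟙-false (s≤s c≤x) = 𝟙-false c≤x

  ∑-𝟙 : ∀ m x → ∑ (suc m) (λ c → 𝟙[ x < c ]) ≡ m ∸ x
  ∑-𝟙 zero    x = sym (0∸n≡0 x)
  ∑-𝟙 (suc m) x with suc m ≤? x
  ... | yes m<x rewrite ∑-𝟙 m x | 𝟙-false m<x | m≤n⇒m∸n≡0 m<x | m≤n⇒m∸n≡0 (<⇒≤ m<x) = refl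
  ... | no  m≮x rewrite ∑-𝟙 m x | 𝟙-true (≰⇒> m≮x) =
    trans (+-comm (m ∸ x) 1) (sym (+-∸-assoc 1 (s≤s⁻¹ (≰⇒> m≮x))))

  -- For monotone f this is also the least i with c ≤ f i, as soon as c ≤ f n. As a sum of
  -- indicators it allows an exchange of summations when it is summed over c.
  #below : (ℕ → ℕ) → ℕ → ℕ → ℕ
  #below f n c = ∑ n (λ i → 𝟙[ f i < c ])

  module _ {f : ℕ → ℕ} (f-mono : ∀ {i j} → i ≤ j → f i ≤ f j) where

    private
      -- The disjunction separates the phase in which every index so far lies below the threshold,
      -- where the count is still n, from the phase after the first index reaching c, where
      -- monotonicity freezes the count.
      #below-spec : ∀ n c → (∀ i → c ≤ f i → #below f n c ≤ i) ×
                    (#below f n c ≡ n ⊎ (#below f n c ≤ n × c ≤ f (#below f n c)))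
      #below-spec zero    c = (λ i _ → z≤n) , inj₁ refl
      #below-spec (suc n) c with c ≤? f n | #below-spec n c
      ... | yes c≤fn | least , bound rewrite 𝟙-false c≤fn | +-identityʳ (#below f n c) =
        least , inj₂ (low bound , high bound)
        where
        low : #below f n c ≡ n ⊎ (#below f n c ≤ n × c ≤ f (#below f n c)) → #below f n c ≤ suc n
        low (inj₁ eq)      = m≤n⇒m≤1+n (≤-reflexive eq)
        low (inj₂ (le , _)) = m≤n⇒m≤1+n le
        high : #below f n c ≡ n ⊎ (#below f n c ≤ n × c ≤ f (#below f n c)) → c ≤ f (#below f n c)
        high (inj₁ eq)      = subst (λ k → c ≤ f k) (sym eq) c≤fn
        high (inj₂ (_ , c≤)) = c≤
      ... | no c≰fn | least , inj₂ (le , c≤) = contradiction (≤-trans c≤ (f-mono le)) c≰fn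
      ... | no c≰fn | least , inj₁ eq rewrite 𝟙-true (≰⇒> c≰fn) | eq | +-comm n 1 =
        (λ i c≤fi → ≰⇒> (λ i≤n → c≰fn (≤-trans c≤fi (f-mono i≤n)))) , inj₁ refl

    #below-least : ∀ n {c i} → c ≤ f i → #below f n c ≤ i
    #below-least n {c} {i} with #below-spec n c
    ... | least , _ = least i

    #below-reaches : ∀ n {c} → c ≤ f n → c ≤ f (#below f n c)
    #below-reaches n {c} c≤fn with #below-spec n c
    ... | _ , inj₁ eq       = subst (λ k → c ≤ f k) (sym eq) c≤fn
    ... | _ , inj₂ (_ , c≤) = c≤

  -- Cardinality and genus

  lookup-injective : ∀ {xs : List ℕ} → Unique xs → ∀ {i j} → lookup xs i ≡ lookup xs j → i ≡ j
  lookup-injective (_  ∷ _)   {zero}  {zero}  eq = refl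
  lookup-injective (x∉ ∷ _)   {zero}  {suc j} eq = contradiction eq (All.lookup x∉ (∈-lookup j))
  lookup-injective (x∉ ∷ _)   {suc i} {zero}  eq = contradiction (sym eq) (All.lookup x∉ (∈-lookup i))
  lookup-injective (_  ∷ xs!) {suc i} {suc j} eq = cong suc (lookup-injective xs! eq)

  enumeration⇒cardinality : ∀ {P : Pred ℕ ℓ} xs → Unique xs → (∀ x → x ∈ P ⇔ x ∈ˡ xs) →
                            HasCardinality P (length xs)
  enumeration⇒cardinality xs xs! P⇔ = lookup xs , lookup-injective xs! , λ x → mk⇔
    (λ Px → let x∈xs = Equivalence.to (P⇔ x) Px in index x∈xs , sym (lookup-index x∈xs))
    (λ (i , eq) → Equivalence.from (P⇔ x) (subst (_∈ˡ xs) eq (∈-lookup i)))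

  -- Selmer's genus formula for the Apéry set {w 0 , … , w (m - 1)} of S with
  -- respect to m; the gaps congruent to w c are the w c / m smaller numbers.
  module _ (m : ℕ) .{{_ : NonZero m}} (S : Pred ℕ ℓ) (w : ℕ → ℕ)
    (w-injective  : ∀ {c d} → c < m → d < m → w c % m ≡ w d % m → c ≡ d)
    (w-surjective : ∀ x → ∃[ c ] (c < m × w c % m ≡ x % m))
    (w-sound      : ∀ {c} j → c < m → w c + j * m ∈ S)
    (w-complete   : ∀ {x} → x ∈ S → ∃[ c ] ∃[ j ] (c < m × x ≡ w c + j * m))
    where

    private
      gap : ℕ → ℕ → ℕ
      gap c t = w c % m + t * m

      gap-% : ∀ c t → gap c t % m ≡ w c % m
      gap-% c t = trans ([m+kn]%n≡m%n (w c % m) t m) (m%n%n≡m%n (w c) m)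

      gap-injective : ∀ c {t u} → gap c t ≡ gap c u → t ≡ u
      gap-injective c {t} {u} eq = *-cancelʳ-≡ t u m (+-cancelˡ-≡ (w c % m) _ _ eq)

      block : ℕ → List ℕ
      block c = applyUpTo (gap c) (w c / m)

      gaps : ℕ → List ℕ
      gaps zero    = []
      gaps (suc k) = gaps k ++ block k

      length-gaps : ∀ k → length (gaps k) ≡ ∑ k (λ c → w c / m)
      length-gaps zero    = refl
      length-gaps (suc k) = trans (length-++ (gaps k))
        (cong₂ _+_ (length-gaps k) (length-applyUpTo (gap k) (w k / m)))

      ∈-gaps⁺ : ∀ {k c t} → c < k → t < w c / m → gap c t ∈ˡ gaps k
      ∈-gaps⁺ {suc k} {c} c<1+k t< with m≤n⇒m<n∨m≡n (s≤s⁻¹ c<1+k)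
      ... | inj₁ c<k  = ∈-++⁺ˡ (∈-gaps⁺ c<k t<)
      ... | inj₂ refl = ∈-++⁺ʳ (gaps k) (∈-applyUpTo⁺ (gap c) t<)

      ∈-gaps⁻ : ∀ {k x} → x ∈ˡ gaps k → ∃[ c ] ∃[ t ] (c < k × t < w c / m × x ≡ gap c t)
      ∈-gaps⁻ {suc k} x∈ with ∈-++⁻ (gaps k) x∈
      ... | inj₁ x∈gaps with c , t , c<k , rest ← ∈-gaps⁻ {k} x∈gaps = c , t , m<n⇒m<1+n c<k , rest
      ... | inj₂ x∈block with t , t< , eq ← ∈-applyUpTo⁻ (gap k) x∈block = k , t , n<1+n k , t< , eq

      gaps-unique : ∀ {k} → k ≤ m → Unique (gaps k)
      gaps-unique {zero}  _   = []
      gaps-unique {suc k} k<m = ++⁺ (gaps-unique (<⇒≤ k<m))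
        (applyUpTo⁺₁ (gap k) _ (λ i<j _ eq → <⇒≢ i<j (gap-injective k eq)))
        disjoint
        where
        disjoint : ∀ {x} → ¬ (x ∈ˡ gaps k × x ∈ˡ block k)
        disjoint (x∈gaps , x∈block)
          with c , t , c<k , _ , refl ← ∈-gaps⁻ {k} x∈gaps
             | u , _ , eq ← ∈-applyUpTo⁻ (gap k) x∈block
          = <⇒≢ c<k (w-injective (<-trans c<k k<m) k<m
              (trans (sym (gap-% c t)) (trans (cong (_% m) eq) (gap-% k u))))

      w-split : ∀ c j → w c + j * m ≡ gap c (w c / m + j)
      w-split c j = begin
        w c + j * m                           ≡⟨ cong (_+ j * m) (m≡m%n+[m/n]*n (w c) m) ⟩
        w c % m + w c / m * m + j * m         ≡⟨ +-assoc (w c % m) _ _ ⟩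
        w c % m + (w c / m * m + j * m)       ≡⟨ cong (w c % m +_) (*-distribʳ-+ m (w c / m) j) ⟨
        gap c (w c / m + j)                   ∎
        where open ≡-Reasoning

      -- In its residue class, x is the entry of index x / m. From index w c / m onward the entries
      -- are w c plus a multiple of m and hence lie in S.
      ∁S⇒gap : ∀ x → x ∈ ∁ S → x ∈ˡ gaps m
      ∁S⇒gap x x∉S with c , c<m , eq ← w-surjective x = x∈gaps
        where
        x≡gap : x ≡ gap c (x / m)
        x≡gap = trans (m≡m%n+[m/n]*n x m) (cong (_+ x / m * m) (sym eq))
        x∈gaps : x ∈ˡ gaps m
        x∈gaps with w c / m ≤? x / m
        ... | no  x/m<  = subst (_∈ˡ gaps m) (sym x≡gap) (∈-gaps⁺ c<m (≰⇒> x/m<))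
        ... | yes w/m≤ = contradiction (subst (_∈ S) w+≡x (w-sound (x / m ∸ w c / m) c<m)) x∉S
          where
          w+≡x : w c + (x / m ∸ w c / m) * m ≡ x
          w+≡x = trans (w-split c _) (trans (cong (gap c) (m+[n∸m]≡n w/m≤)) (sym x≡gap))

      -- An element of S has the form w d + j m. Its residue forces d = c, and then its index in the
      -- class is w c / m + j, too large for a gap.
      gap⇒∁S : ∀ x → x ∈ˡ gaps m → x ∈ ∁ S
      gap⇒∁S x x∈gaps x∈S
        with c , t , c<m , t< , refl ← ∈-gaps⁻ {m} x∈gaps
           | d , j , d<m , eq ← w-complete x∈S
        with refl ← w-injective c<m d<m
               (trans (sym (gap-% c t)) (trans (cong (_% m) eq) ([m+kn]%n≡m%n (w d) j m)))
        = m+n≮m (w c / m) j (subst (_< w c / m) (gap-injective c (trans eq (w-split c j))) t<)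

    genus-of-Apéry : HasGenus S (∑ m (λ c → w c / m))
    genus-of-Apéry = subst (HasGenus S) (length-gaps m)
      (enumeration⇒cardinality (gaps m) (gaps-unique ≤-refl) (λ x → mk⇔ (∁S⇒gap x) (gap⇒∁S x)))

  -- Residues

  module _ {m : ℕ} .{{_ : NonZero m}} where

    -- Divisibility of x + t by m stands for x ≡ - t (mod m), which keeps subtraction out.
    ∣+⇒%≡ : ∀ x y t → m ∣ x + t → m ∣ y + t → x % m ≡ y % m
    ∣+⇒%≡ x y t m∣x+t m∣y+t = begin
      x % m             ≡⟨ %-remove-+ʳ x m∣y+t ⟨
      (x + (y + t)) % m ≡⟨ cong (_% m) (rotate x y t) ⟩
      (y + (x + t)) % m ≡⟨ %-remove-+ʳ y m∣x+t ⟩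
      y % m             ∎
      where
      open ≡-Reasoning
      rotate : ∀ x y t → x + (y + t) ≡ y + (x + t)
      rotate = solve-∀

    ∣+-resp-%≡ : ∀ x y t → x % m ≡ y % m → m ∣ x + t → m ∣ y + t
    ∣+-resp-%≡ x y t eq m∣x+t = m%n≡0⇒n∣m (y + t) m (begin
      (y + t) % m         ≡⟨ %-distribˡ-+ y t m ⟩
      (y % m + t % m) % m ≡⟨ cong (λ r → (r + t % m) % m) eq ⟨
      (x % m + t % m) % m ≡⟨ %-distribˡ-+ x t m ⟨
      (x + t) % m         ≡⟨ n∣m⇒m%n≡0 (x + t) m m∣x+t ⟩
      0                   ∎)
      where open ≡-Reasoning

    *-congʳ-% : ∀ k x y → x % m ≡ y % m → (k * x) % m ≡ (k * y) % m
    *-congʳ-% k x y eq = begin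
      (k * x) % m             ≡⟨ %-distribˡ-* k x m ⟩
      (k % m * (x % m)) % m   ≡⟨ cong (λ r → (k % m * r) % m) eq ⟩
      (k % m * (y % m)) % m   ≡⟨ %-distribˡ-* k y m ⟨
      (k * y) % m             ∎
      where open ≡-Reasoning

  coprime⇒negative-inverse : ∀ a m .{{_ : NonZero m}} → Coprime a m → ∃[ v ] (m ∣ a * v + 1)
  coprime⇒negative-inverse a m@(suc M) coprime with coprime-Bézout coprime
  ... | Bézout.-+ x y eq = x , divides y (trans (+-comm (a * x) 1) (trans (cong suc (*-comm a x)) eq))
  -- Here a x ≡ 1 (mod m), so the inverse is multiplied by M ≡ - 1.
  ... | Bézout.+- x y eq = x * M , divides (1 + y * M) (begin
    a * (x * M) + 1     ≡⟨ regroup a x M ⟩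
    x * a * M + 1       ≡⟨ cong (λ z → z * M + 1) eq ⟨
    (1 + y * m) * M + 1 ≡⟨ factor y M ⟩
    (1 + y * M) * m     ∎)
    where
    open ≡-Reasoning
    regroup : ∀ a x M → a * (x * M) + 1 ≡ x * a * M + 1
    regroup = solve-∀
    factor : ∀ y M → (1 + y * suc M) * M + 1 ≡ (1 + y * M) * suc M
    factor = solve-∀

  -- m = 1 + M; since a is invertible modulo m, the numbers w c ≡ - a c form a
  -- complete residue system, and w c and w (m - c) have opposite residues.
  module Residues (M a v : ℕ) (m∣av+1 : suc M ∣ a * v + 1) (w V : ℕ → ℕ)
    (w+ac≡mV : ∀ {c} → c < suc M → w c + a * c ≡ suc M * V c) (w0≡0 : w 0 ≡ 0)
    where

    private
      m : ℕ
      m = suc M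

      m∣w+ac : ∀ {c} → c < m → m ∣ w c + a * c
      m∣w+ac {c} c<m = divides (V c) (trans (w+ac≡mV c<m) (*-comm m (V c)))

      -- Since a v ≡ - 1, multiplying by v turns a c into - c, which undoes c ↦ a c.
      m∣vac+c : ∀ c → m ∣ v * (a * c) + c
      m∣vac+c c = subst (m ∣_) (regroup a v c) (∣-trans m∣av+1 (m∣m*n c))
        where
        regroup : ∀ a v c → (a * v + 1) * c ≡ v * (a * c) + c
        regroup = solve-∀

    -- From w c ≡ - a c it follows that a c ≡ a d; multiplication by v then gives c ≡ d, which is an
    -- equality below m.
    w-injective : ∀ {c d} → c < m → d < m → w c % m ≡ w d % m → c ≡ d
    w-injective {c} {d} c<m d<m eq = begin
      c     ≡⟨ m<n⇒m%n≡m c<m ⟨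
      c % m ≡⟨ ∣+⇒%≡ c d (v * (a * d))
                 (subst (m ∣_) (+-comm _ c)
                   (∣+-resp-%≡ (v * (a * c)) (v * (a * d)) c (*-congʳ-% v (a * c) (a * d) ac≡ad) (m∣vac+c c)))
                 (subst (m ∣_) (+-comm _ d) (m∣vac+c d)) ⟩
      d % m ≡⟨ m<n⇒m%n≡m d<m ⟩
      d     ∎
      where
      open ≡-Reasoning
      ac≡ad : (a * c) % m ≡ (a * d) % m
      ac≡ad = ∣+⇒%≡ (a * c) (a * d) (w d)
        (subst (m ∣_) (+-comm (w d) _) (∣+-resp-%≡ (w c) (w d) (a * c) eq (m∣w+ac c<m)))
        (subst (m ∣_) (+-comm (w d) _) (m∣w+ac d<m))

    w-surjective : ∀ x → ∃[ c ] (c < m × w c % m ≡ x % m)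
    w-surjective x = c , c<m , ∣+⇒%≡ (w c) x (a * c) (m∣w+ac c<m)
      (subst (m ∣_) (+-comm (a * c) x)
        (∣+-resp-%≡ (a * (v * x)) (a * c) x
          (*-congʳ-% a (v * x) c (sym (m%n%n≡m%n (v * x) m)))
          (subst (m ∣_) (regroup a v x) (∣-trans m∣av+1 (m∣m*n x)))))
      where
      -- This choice gives a c ≡ a v x ≡ - x, hence w c ≡ - a c ≡ x.
      c = (v * x) % m
      c<m : c < m
      c<m = m%n<n (v * x) m
      regroup : ∀ a v x → (a * v + 1) * x ≡ a * (v * x) + x
      regroup = solve-∀

    private
      r : ℕ → ℕ
      r c = w c % m

      -- With c = 1 + i and d = m - c, w c + w d ≡ - a (c + d) ≡ 0 modulo m. The two residues thus
      -- add up to a multiple of m that is positive, as r c ≠ 0, and less than 2 m.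
      r-complement : ∀ {i} → i < M → r (suc i) + r (suc (M ∸ suc i)) ≡ m
      r-complement {i} i<M = between (m%n<n (w c) m) (m%n<n (w d) m) r≢0 m∣r+r
        where
        c = suc i
        d = suc (M ∸ suc i)
        c<m : c < m
        c<m = s≤s i<M
        c+d≡m : c + d ≡ m
        c+d≡m = trans (+-suc c (M ∸ suc i)) (cong suc (m+[n∸m]≡n i<M))
        d<m : d < m
        d<m = ≤-trans (m<n+m d z<s) (≤-reflexive c+d≡m)
        r≢0 : r c ≢ 0
        r≢0 rc≡0 with () ← w-injective c<m z<s (trans rc≡0 (sym (cong (_% m) w0≡0)))
        regroup : ∀ x y a c d → (x + a * c) + (y + a * d) ≡ a * (c + d) + (x + y)
        regroup = solve-∀
        m∣w+w : m ∣ w c + w d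
        m∣w+w = ∣m+n∣m⇒∣n
          (subst (m ∣_) (regroup (w c) (w d) a c d) (∣m∣n⇒∣m+n (m∣w+ac c<m) (m∣w+ac d<m)))
          (subst (λ z → m ∣ a * z) (sym c+d≡m) (n∣m*n a))
        m∣r+r : m ∣ r c + r d
        m∣r+r = m%n≡0⇒n∣m _ m (trans (sym (%-distribˡ-+ (w c) (w d) m)) (n∣m⇒m%n≡0 _ m m∣w+w))
        between : ∀ {x y} → x < m → y < m → x ≢ 0 → m ∣ x + y → x + y ≡ m
        between x<m y<m x≢0 (divides zero eq) = contradiction (m+n≡0⇒m≡0 _ eq) x≢0
        between x<m y<m x≢0 (divides 1 eq) = trans eq (*-identityˡ m)
        between {x} {y} x<m y<m x≢0 (divides (2+ q) eq) =
          contradiction (+-mono-< x<m y<m) (≤⇒≯ (≤-trans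
            (≤-trans (m≤m+n (m + m) (q * m)) (≤-reflexive (+-assoc m m (q * m)))) (≤-reflexive (sym eq))))

      2∑r : 2 * ∑ m r ≡ M * m
      2∑r = begin
        2 * ∑ m r                     ≡⟨ cong (2 *_) (∑-split 1 M r) ⟩
        2 * (r 0 + ∑ M (r ∘ suc))     ≡⟨ cong (λ z → 2 * (z % m + ∑ M (r ∘ suc))) w0≡0 ⟩
        2 * ∑ M (r ∘ suc)             ≡⟨ ∑-antisymmetric M m (r ∘ suc) r-complement ⟩
        M * m                         ∎
        where open ≡-Reasoning

      2∑id : 2 * ∑ m id ≡ M * m
      2∑id = +-cancelʳ-≡ m _ _ (trans (∑-id m) (+-comm m (M * m)))

    -- Selmer's formula: w c + a c = m V c is summed over c < m, with w c written as r c + m (w c /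
    -- m). The residues r c and the indices c both have sum M m / 2, so a factor m cancels.
    2∑[w/m]+[1+a]M≡2∑V : 2 * ∑ m (λ c → w c / m) + suc a * M ≡ 2 * ∑ m V
    2∑[w/m]+[1+a]M≡2∑V = *-cancelˡ-≡ _ _ m (begin
      m * (2 * Q + suc a * M)                   ≡⟨ regroup M a Q ⟩
      M * m + 2 * (m * Q) + a * (M * m)         ≡⟨ cong₂ (λ x y → x + 2 * (m * Q) + a * y) 2∑r 2∑id ⟨
      2 * ∑ m r + 2 * (m * Q) + a * (2 * ∑ m id) ≡⟨ factor (∑ m r) (m * Q) a (∑ m id) ⟩
      2 * (∑ m r + m * Q + a * ∑ m id)          ≡⟨ cong₂ (λ x y → 2 * (∑ m r + x + y)) (*-distribˡ-∑ m m _) (*-distribˡ-∑ m a id) ⟨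
      2 * (∑ m r + ∑ m (λ c → m * (w c / m)) + ∑ m (a *_))
                                                ≡⟨ cong (λ x → 2 * (x + ∑ m (a *_))) (∑-distrib-+ m r _) ⟨
      2 * (∑ m (λ c → r c + m * (w c / m)) + ∑ m (a *_))
                                                ≡⟨ cong (2 *_) (∑-distrib-+ m _ (a *_)) ⟨
      2 * ∑ m (λ c → r c + m * (w c / m) + a * c) ≡⟨ cong (2 *_) (∑-cong m pointwise) ⟩
      2 * ∑ m (λ c → m * V c)                   ≡⟨ cong (2 *_) (*-distribˡ-∑ m m V) ⟩
      2 * (m * ∑ m V)                           ≡⟨ swap 2 m (∑ m V) ⟩
      m * (2 * ∑ m V)                           ∎)
      where
      open ≡-Reasoning
      Q = ∑ m (λ c → w c / m)
      pointwise : ∀ {c} → c < m → r c + m * (w c / m) + a * c ≡ m * V c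
      pointwise {c} c<m = trans
        (cong (_+ a * c) (trans (cong (r c +_) (*-comm m (w c / m))) (sym (m≡m%n+[m/n]*n (w c) m))))
        (w+ac≡mV c<m)
      regroup : ∀ M a Q → suc M * (2 * Q + suc a * M) ≡ M * suc M + 2 * (suc M * Q) + a * (M * suc M)
      regroup = solve-∀
      factor : ∀ x y a z → 2 * x + 2 * y + a * (2 * z) ≡ 2 * (x + y + a * z)
      factor = solve-∀
      swap : ∀ x y z → x * (y * z) ≡ y * (x * z)
      swap = solve-∀

  -- Legendre's function x ↦ ∑ⱼ ⌊x / bʲ⌋

  module Legendre (β : ℕ) where

    a b : ℕ
    a = suc β
    b = suc a

    -- Only the terms with j < k; taking k = x loses nothing, as x < bʲ for j ≥ x.
    F′ : ℕ → ℕ → ℕ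
    F′ zero    x = 0
    F′ (suc k) x = x + F′ k (x / b)

    F : ℕ → ℕ
    F x = F′ x x

    private
      [1+x]/b≤x : ∀ x → suc x / b ≤ x
      [1+x]/b≤x x = s≤s⁻¹ (m/n<m (suc x) b (s≤s (s≤s z≤n)))

      F′-zero : ∀ k → F′ k 0 ≡ 0
      F′-zero zero    = refl
      F′-zero (suc k) = trans (cong (F′ k) (0/n≡0 b)) (F′-zero k)

      F′-stable : ∀ {k l x} → x ≤ k → x ≤ l → F′ k x ≡ F′ l x
      F′-stable {k} {l} {zero} _ _ = trans (F′-zero k) (sym (F′-zero l))
      F′-stable {suc k} {suc l} {suc x} (s≤s x≤k) (s≤s x≤l) =
        cong (suc x +_) (F′-stable (≤-trans ([1+x]/b≤x x) x≤k) (≤-trans ([1+x]/b≤x x) x≤l))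

      /-superadditive : ∀ x y → x / b + y / b ≤ (x + y) / b
      /-superadditive x y = ≤-trans
        (≤-reflexive (sym (m*n/n≡m (x / b + y / b) b)))
        (/-monoˡ-≤ b (≤-trans (≤-reflexive (*-distribʳ-+ b (x / b) (y / b)))
          (+-mono-≤ (m/n*n≤m x b) (m/n*n≤m y b))))

      F′-mono : ∀ k {x y} → x ≤ y → F′ k x ≤ F′ k y
      F′-mono zero    x≤y = z≤n
      F′-mono (suc k) x≤y = +-mono-≤ x≤y (F′-mono k (/-monoˡ-≤ b x≤y))

      F′-superadditive : ∀ k x y → F′ k x + F′ k y ≤ F′ k (x + y)
      F′-superadditive zero    x y = z≤n
      F′-superadditive (suc k) x y = begin
        x + F′ k (x / b) + (y + F′ k (y / b))   ≡⟨ interchange x y _ _ ⟩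
        x + y + (F′ k (x / b) + F′ k (y / b))   ≤⟨ +-monoʳ-≤ (x + y) (F′-superadditive k (x / b) (y / b)) ⟩
        x + y + F′ k (x / b + y / b)            ≤⟨ +-monoʳ-≤ (x + y) (F′-mono k (/-superadditive x y)) ⟩
        x + y + F′ k ((x + y) / b)              ∎
        where
        open ≤-Reasoning
        interchange : ∀ x y z w → x + z + (y + w) ≡ x + y + (z + w)
        interchange = solve-∀

      -- Comparison with the geometric series of sum b x / a. Strictness survives the induction
      -- because the tail starts at x / b: either this is 0 and 1 ≤ x is enough, or b (x / b) ≤ x.
      F′-bound : ∀ k {x} → 0 < x → a * F′ k x + 1 ≤ b * x
      F′-bound zero    {suc x} _ rewrite *-zeroʳ a = s≤s z≤n
      F′-bound (suc k) {x} 0<x = begin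
        a * (x + F′ k (x / b)) + 1     ≡⟨ expand a x _ ⟩
        a * x + (a * F′ k (x / b) + 1) ≤⟨ +-monoʳ-≤ (a * x) (tail (x / b) refl) ⟩
        a * x + x                      ≡⟨ +-comm (a * x) x ⟩
        b * x                          ∎
        where
        open ≤-Reasoning
        expand : ∀ a x y → a * (x + y) + 1 ≡ a * x + (a * y + 1)
        expand = solve-∀
        tail : ∀ q → x / b ≡ q → a * F′ k q + 1 ≤ x
        tail zero    _  rewrite F′-zero k | *-zeroʳ a = 0<x
        tail (suc q) eq = begin
          a * F′ k (suc q) + 1 ≤⟨ F′-bound k z<s ⟩
          b * suc q            ≡⟨ cong (b *_) eq ⟨
          b * (x / b)          ≡⟨ *-comm b (x / b) ⟩
          x / b * b            ≤⟨ m/n*n≤m x b ⟩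
          x                    ∎

    F-step : ∀ x → F x ≡ x + F (x / b)
    F-step zero    = sym (cong F (0/n≡0 b))
    F-step (suc x) = cong (suc x +_) (F′-stable ([1+x]/b≤x x) ≤-refl)

    F-superadditive : ∀ x y → F x + F y ≤ F (x + y)
    F-superadditive x y = ≤-trans
      (≤-reflexive (cong₂ _+_ (F′-stable {l = x + y} ≤-refl (m≤m+n x y)) (F′-stable {l = x + y} ≤-refl (m≤n+m y x))))
      (F′-superadditive (x + y) x y)

    F-mono : ∀ {x y} → x ≤ y → F x ≤ F y
    F-mono {x} {y} x≤y = ≤-trans (≤-reflexive (F′-stable ≤-refl x≤y)) (F′-mono y x≤y)

    x≤Fx : ∀ x → x ≤ F x
    x≤Fx x = ≤-trans (m≤m+n x _) (≤-reflexive (sym (F-step x)))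

    F-bound : ∀ {x} → 0 < x → a * F x + 1 ≤ b * x
    F-bound {x} = F′-bound x

    -- By Legendre's formula, a * L x is x minus the sum of its base-b digits.
    L : ℕ → ℕ
    L x = F (x / b)

    L-superadditive : ∀ x y → L x + L y ≤ L (x + y)
    L-superadditive x y = ≤-trans (F-superadditive (x / b) (y / b)) (F-mono (/-superadditive x y))

    [x*b]/b≡x : ∀ x → (x * b) / b ≡ x
    [x*b]/b≡x x = m*n/n≡m x b

    [b*x]/b≡x : ∀ x → (b * x) / b ≡ x
    [b*x]/b≡x x = trans (cong (_/ b) (*-comm b x)) ([x*b]/b≡x x)

    -- The base-b digit sum of bⁱ is 1. This places a single generator at V = bⁱ with c = L V.
    aL[bⁱ]+1≡bⁱ : ∀ i → a * L (b ^ i) + 1 ≡ b ^ i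
    aL[bⁱ]+1≡bⁱ zero = cong (_+ 1) (trans (cong (a *_) (cong F (m<n⇒m/n≡0 {1} {b} (s≤s (s≤s z≤n))))) (*-zeroʳ a))
    aL[bⁱ]+1≡bⁱ (suc i) = begin
      a * L (b * b ^ i) + 1            ≡⟨ cong (λ z → a * F z + 1) ([b*x]/b≡x (b ^ i)) ⟩
      a * F (b ^ i) + 1                ≡⟨ cong (λ z → a * z + 1) (F-step (b ^ i)) ⟩
      a * (b ^ i + L (b ^ i)) + 1      ≡⟨ expand a (b ^ i) _ ⟩
      a * b ^ i + (a * L (b ^ i) + 1)  ≡⟨ cong (a * b ^ i +_) (aL[bⁱ]+1≡bⁱ i) ⟩
      a * b ^ i + b ^ i                ≡⟨ +-comm (a * b ^ i) (b ^ i) ⟩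
      b * b ^ i                        ∎
      where
      open ≡-Reasoning
      expand : ∀ a x y → a * (x + y) + 1 ≡ a * x + (a * y + 1)
      expand = solve-∀

    -- A = b² - 1
    A : ℕ
    A = a * (2 + a)

    -- In base b, the number b² - 1 has the digits a, a.
    A/b≡a : A / b ≡ a
    A/b≡a = trans (cong (_/ b) (regroup a)) (trans (+-distrib-/-∣ˡ a {b} (n∣m*n a))
      (trans (cong₂ _+_ ([x*b]/b≡x a) (m<n⇒m/n≡0 (n<1+n a))) (+-identityʳ a)))
      where
      regroup : ∀ a → a * (2 + a) ≡ a * suc a + a
      regroup = solve-∀

    Fa≡a : F a ≡ a
    Fa≡a = trans (F-step a) (trans (cong (λ z → a + F z) (m<n⇒m/n≡0 (n<1+n a))) (+-identityʳ a))

    F[A]≡A+a : F A ≡ A + a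
    F[A]≡A+a = trans (F-step A) (cong (A +_) (trans (cong F A/b≡a) Fa≡a))

    F[b*x]≡b*x+F[x] : ∀ x → F (b * x) ≡ b * x + F x
    F[b*x]≡b*x+F[x] x = trans (F-step (b * x)) (cong (λ z → b * x + F z) ([b*x]/b≡x x))

    -- The terms of F (A bᵏ) are A bᵏ, ..., A b, A, a, and multiplying the argument by b prepends
    -- one more. For k = n - 1 the right side is M.
    F[Abᵏ]+2 : ∀ k → F (A * b ^ k) + 2 ≡ (b + 1) * b ^ suc k
    F[Abᵏ]+2 zero = begin
      F (A * 1) + 2     ≡⟨ cong (λ z → F z + 2) (*-identityʳ A) ⟩
      F A + 2           ≡⟨ cong (_+ 2) F[A]≡A+a ⟩
      A + a + 2         ≡⟨ regroup a ⟩
      (b + 1) * (b * 1) ∎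
      where
      open ≡-Reasoning
      regroup : ∀ a → a * (2 + a) + a + 2 ≡ (suc a + 1) * (suc a * 1)
      regroup = solve-∀
    F[Abᵏ]+2 (suc k) = begin
      F (A * (b * b ^ k)) + 2                ≡⟨ cong (λ z → F z + 2) (swap A b (b ^ k)) ⟩
      F (b * (A * b ^ k)) + 2                ≡⟨ cong (_+ 2) (F[b*x]≡b*x+F[x] (A * b ^ k)) ⟩
      b * (A * b ^ k) + F (A * b ^ k) + 2    ≡⟨ +-assoc (b * (A * b ^ k)) _ 2 ⟩
      b * (A * b ^ k) + (F (A * b ^ k) + 2)  ≡⟨ cong (b * (A * b ^ k) +_) (F[Abᵏ]+2 k) ⟩
      b * (A * b ^ k) + (b + 1) * (b * b ^ k) ≡⟨ regroup a (b ^ k) ⟩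
      (b + 1) * (b * (b * b ^ k))            ∎
      where
      open ≡-Reasoning
      swap : ∀ x y z → x * (y * z) ≡ y * (x * z)
      swap = solve-∀
      regroup : ∀ a x → suc a * (a * (2 + a) * x) + (suc a + 1) * (suc a * x) ≡ (suc a + 1) * (suc a * (suc a * x))
      regroup = solve-∀

    -- Adding 1 to a multiple of b leaves the quotient by b unchanged, so only the leading term of F
    -- grows.
    F[b*x+1] : ∀ x → F (b * x + 1) ≡ F (b * x) + 1
    F[b*x+1] x = begin
      F (b * x + 1)                 ≡⟨ F-step (b * x + 1) ⟩
      b * x + 1 + F ((b * x + 1) / b) ≡⟨ cong (λ z → b * x + 1 + F z) quotient≡ ⟩
      b * x + 1 + F x               ≡⟨ swap (b * x) 1 (F x) ⟩
      b * x + F x + 1               ≡⟨ cong (_+ 1) (F[b*x]≡b*x+F[x] x) ⟨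
      F (b * x) + 1                 ∎
      where
      open ≡-Reasoning
      swap : ∀ x y z → x + y + z ≡ x + z + y
      swap = solve-∀
      quotient≡ : (b * x + 1) / b ≡ x
      quotient≡ = trans (+-distrib-/-∣ˡ 1 (m∣m*n x))
        (trans (cong₂ _+_ ([b*x]/b≡x x) (m<n⇒m/n≡0 {1} {b} (s≤s (s≤s z≤n)))) (+-identityʳ x))

    -- Sums of Legendre's function.

    G : ℕ → ℕ
    G n = ∑ n F

    -- F i = i + F (i / b) is summed over i < b n: the first part is a triangular number, and in the
    -- second every quotient below n occurs b times.
    2G[b*n] : ∀ n → 2 * G (b * n) + b * n ≡ (b * n) * (b * n) + b * (2 * G n)
    2G[b*n] n = begin
      2 * G (b * n) + b * n                         ≡⟨ cong (λ z → 2 * z + b * n) split ⟩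
      2 * (∑ (b * n) id + b * G n) + b * n          ≡⟨ regroup (∑ (b * n) id) b (G n) (b * n) ⟩
      (2 * ∑ (b * n) id + b * n) + b * (2 * G n)    ≡⟨ cong (_+ b * (2 * G n)) (∑-id (b * n)) ⟩
      (b * n) * (b * n) + b * (2 * G n)             ∎
      where
      open ≡-Reasoning
      regroup : ∀ s b g n → 2 * (s + b * g) + n ≡ (2 * s + n) + b * (2 * g)
      regroup = solve-∀
      split : G (b * n) ≡ ∑ (b * n) id + b * G n
      split = begin
        ∑ (b * n) F                               ≡⟨ ∑-cong (b * n) (λ {i} _ → F-step i) ⟩
        ∑ (b * n) (λ i → i + F (i / b))           ≡⟨ ∑-distrib-+ (b * n) id _ ⟩
        ∑ (b * n) id + ∑ (b * n) (λ i → F (i / b)) ≡⟨ cong (λ z → ∑ (b * n) id + ∑ z (λ i → F (i / b))) (*-comm b n) ⟩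
        ∑ (b * n) id + ∑ (n * b) (λ i → F (i / b)) ≡⟨ cong (∑ (b * n) id +_) (∑-quotients b n F) ⟩
        ∑ (b * n) id + b * G n                    ∎

    2G[A] : 2 * G A + a * (3 * a + 7) ≡ A * (b + 1) * b
    -- As b² = A + 1, adding 2 F A extends G A to G (b²), to which `2G[b*n]` applies with n = b and
    -- then n = 1. The two b² supply the linear terms on its left side, the second one after
    -- multiplication by b.
    2G[A] = +-cancelʳ-≡ (2 * F A + (b * b + b * b)) _ _ (begin
      2 * G A + a * (3 * a + 7) + (2 * F A + (b * b + b * b))
        ≡⟨ regroup₁ (G A) (F A) (b * b) (a * (3 * a + 7)) ⟩
      2 * (G A + F A) + b * b + b * b + a * (3 * a + 7)
        ≡⟨ cong (λ z → 2 * ∑ z F + b * b + b * b + a * (3 * a + 7)) (b² a) ⟨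
      2 * G (b * b) + b * b + b * b + a * (3 * a + 7)
        ≡⟨ cong (λ z → z + b * b + a * (3 * a + 7)) (2G[b*n] b) ⟩
      b * b * (b * b) + b * (2 * G b) + b * b + a * (3 * a + 7)
        ≡⟨ regroup₂ b (2 * G b) (a * (3 * a + 7)) ⟩
      b * b * (b * b) + b * (2 * G b + b) + a * (3 * a + 7)
        ≡⟨ cong (λ z → b * b * (b * b) + b * z + a * (3 * a + 7)) 2G[b] ⟩
      b * b * (b * b) + b * (b * b) + a * (3 * a + 7)
        ≡⟨ regroup₃ a ⟩
      A * (b + 1) * b + (2 * (A + a) + (b * b + b * b))
        ≡⟨ cong (λ z → A * (b + 1) * b + (2 * z + (b * b + b * b))) F[A]≡A+a ⟨
      A * (b + 1) * b + (2 * F A + (b * b + b * b)) ∎)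
      where
      open ≡-Reasoning
      b² : ∀ a → suc a * suc a ≡ suc (a * (2 + a))
      b² = solve-∀
      2G[b] : 2 * G b + b ≡ b * b
      2G[b] = begin
        2 * G b + b                         ≡⟨ cong (λ z → 2 * G z + z) (*-identityʳ b) ⟨
        2 * G (b * 1) + b * 1               ≡⟨ 2G[b*n] 1 ⟩
        (b * 1) * (b * 1) + b * (2 * G 1)   ≡⟨ regroup b ⟩
        b * b                               ∎
        where
        regroup : ∀ b → (b * 1) * (b * 1) + b * 0 ≡ b * b
        regroup = solve-∀
      regroup₁ : ∀ g f x y → 2 * g + y + (2 * f + (x + x)) ≡ 2 * (g + f) + x + x + y
      regroup₁ = solve-∀
      regroup₂ : ∀ b g y → b * b * (b * b) + b * g + b * b + y ≡ b * b * (b * b) + b * (g + b) + y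
      regroup₂ = solve-∀
      regroup₃ : ∀ a → suc a * suc a * (suc a * suc a) + suc a * (suc a * suc a) + a * (3 * a + 7)
               ≡ a * (2 + a) * (suc a + 1) * suc a + (2 * (a * (2 + a) + a) + (suc a * suc a + suc a * suc a))
      regroup₃ = solve-∀

    -- Induction by `2G[b*n]`, whose linear term b n adds A to the coefficient of bᵏ at each step;
    -- the constant part of that coefficient comes from `2G[A]`.
    2G[Abᵏ] : ∀ k → 2 * G (A * b ^ k) + (A * k + a * (3 * a + 7)) * b ^ k
                  ≡ A * (b + 1) * b * (b ^ k * b ^ k)
    2G[Abᵏ] zero = begin
      2 * G (A * 1) + (A * 0 + a * (3 * a + 7)) * 1 ≡⟨ cong₂ (λ x y → 2 * G x + y) (*-identityʳ A) (regroup A (a * (3 * a + 7))) ⟩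
      2 * G A + a * (3 * a + 7)                     ≡⟨ 2G[A] ⟩
      A * (b + 1) * b                               ≡⟨ *-identityʳ (A * (b + 1) * b) ⟨
      A * (b + 1) * b * 1                           ∎
      where
      open ≡-Reasoning
      regroup : ∀ x y → (x * 0 + y) * 1 ≡ y
      regroup = solve-∀
    2G[Abᵏ] (suc k) = begin
      2 * G (A * (b * P)) + (A * suc k + C) * (b * P)
        ≡⟨ cong (λ z → 2 * G z + (A * suc k + C) * (b * P)) (swap A b P) ⟩
      2 * G (b * N) + (A * suc k + C) * (b * P)
        ≡⟨ regroup₁ (2 * G (b * N)) A k C b P ⟩
      2 * G (b * N) + b * N + b * ((A * k + C) * P)
        ≡⟨ cong (_+ b * ((A * k + C) * P)) (2G[b*n] N) ⟩
      (b * N) * (b * N) + b * (2 * G N) + b * ((A * k + C) * P)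
        ≡⟨ regroup₂ ((b * N) * (b * N)) b (2 * G N) ((A * k + C) * P) ⟩
      (b * N) * (b * N) + b * (2 * G N + (A * k + C) * P)
        ≡⟨ cong (λ z → (b * N) * (b * N) + b * z) (2G[Abᵏ] k) ⟩
      (b * N) * (b * N) + b * (A * (b + 1) * b * (P * P))
        ≡⟨ regroup₃ a P ⟩
      A * (b + 1) * b * (b * P * (b * P)) ∎
      where
      open ≡-Reasoning
      P = b ^ k
      N = A * P
      C = a * (3 * a + 7)
      swap : ∀ x y z → x * (y * z) ≡ y * (x * z)
      swap = solve-∀
      regroup₁ : ∀ g A k C b P → g + (A * suc k + C) * (b * P) ≡ g + b * (A * P) + b * ((A * k + C) * P)
      regroup₁ = solve-∀
      regroup₂ : ∀ x b g y → x + b * g + b * y ≡ x + b * (g + y)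
      regroup₂ = solve-∀
      regroup₃ : ∀ a P → (suc a * (a * (2 + a) * P)) * (suc a * (a * (2 + a) * P)) + suc a * (a * (2 + a) * (suc a + 1) * suc a * (P * P))
               ≡ a * (2 + a) * (suc a + 1) * suc a * (suc a * P * (suc a * P))
      regroup₃ = solve-∀

  -- The semigroup

  *-closed : ∀ {ℓ} {G : Pred ℕ ℓ} k {x} → x ∈ ⟨ G ⟩ → k * x ∈ ⟨ G ⟩
  *-closed zero    x∈ = zero
  *-closed (suc k) x∈ = plus x∈ (*-closed k x∈)

  module Semigroup (β n : ℕ) where

    open Legendre β public

    M m : ℕ
    M = (b + 1) * b ^ n
    m = suc M

    s : ℕ → ℕ
    s i = M * b ^ i + 1

    S : Pred ℕ _
    S = T′ b n

    s′≡s : ∀ i → s′ b n i ≡ s i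
    s′≡s i = cong (_+ 1) (trans (cong ((b + 1) *_) (^-distribˡ-+-* b n i)) (sym (*-assoc (b + 1) (b ^ n) (b ^ i))))

    s∈S : ∀ i → s i ∈ S
    s∈S i = gen (i , sym (s′≡s i))

    s0≡m : s 0 ≡ m
    s0≡m = trans (cong (_+ 1) (*-identityʳ M)) (+-comm M 1)

    m∈S : m ∈ S
    m∈S = subst (_∈ S) s0≡m (s∈S 0)

    b*s : ∀ i → b * s i ≡ s (suc i) + a
    b*s i = regroup a M (b ^ i)
      where
      regroup : ∀ a M x → suc a * (M * x + 1) ≡ M * (suc a * x) + 1 + a
      regroup = solve-∀

    -- Replacing b copies of s i by one copy of s (1 + i) lowers a sum by a; from
    -- V copies of s i this can be done c times for every c ≤ L V.
    private
      carry′ : ∀ f V i c → c ≤ F′ f (V / b) → ∃[ y ] (y ∈ S × y + a * c ≡ V * s i)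
      carry′ zero    V i zero _ = V * s i , *-closed V (s∈S i) , trans (cong (V * s i +_) (*-zeroʳ a)) (+-identityʳ _)
      carry′ (suc f) V i c c≤ with c ≤? V / b
      -- The current level alone has room for all c carries.
      ... | yes c≤V/b = c * s (suc i) + e * s i , plus (*-closed c (s∈S (suc i))) (*-closed e (s∈S i)) , (begin
        c * s (suc i) + e * s i + a * c       ≡⟨ regroup₁ c (s (suc i)) (e * s i) a ⟩
        c * (s (suc i) + a) + e * s i         ≡⟨ cong (λ z → c * z + e * s i) (b*s i) ⟨
        c * (b * s i) + e * s i               ≡⟨ regroup₂ c b (s i) e ⟩
        (c * b + e) * s i                     ≡⟨ cong (_* s i) (m+[n∸m]≡n c*b≤V) ⟩
        V * s i                               ∎)
        where
        open ≡-Reasoning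
        e = V ∸ c * b
        c*b≤V : c * b ≤ V
        c*b≤V = ≤-trans (*-monoˡ-≤ b c≤V/b) (m/n*n≤m V b)
        regroup₁ : ∀ c x y a → c * x + y + a * c ≡ c * (x + a) + y
        regroup₁ = solve-∀
        regroup₂ : ∀ c b x e → c * (b * x) + e * x ≡ (c * b + e) * x
        regroup₂ = solve-∀
      -- All q = V / b carries of this level are made. The other c - q are made by recursion among
      -- the resulting q copies of s (1 + i), and r copies of s i stay.
      ... | no c≰V/b with y , y∈S , eq ← carry′ f (V / b) (suc i) (c ∸ V / b)
                           (≤-trans (∸-monoˡ-≤ (V / b) c≤) (≤-reflexive (m+n∸m≡n (V / b) _)))
        = y + r * s i , plus y∈S (*-closed r (s∈S i)) , (begin
        y + r * s i + a * c                   ≡⟨ cong (λ z → y + r * s i + a * z) (m+[n∸m]≡n (≰⇒≥ c≰V/b)) ⟨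
        y + r * s i + a * (q + (c ∸ q))       ≡⟨ regroup₁ y (r * s i) a q (c ∸ q) ⟩
        (y + a * (c ∸ q)) + (q * a + r * s i) ≡⟨ cong (_+ (q * a + r * s i)) eq ⟩
        q * s (suc i) + (q * a + r * s i)     ≡⟨ regroup₂ q (s (suc i)) a (r * s i) ⟩
        q * (s (suc i) + a) + r * s i         ≡⟨ cong (λ z → q * z + r * s i) (b*s i) ⟨
        q * (b * s i) + r * s i               ≡⟨ regroup₃ q b (s i) r ⟩
        (r + q * b) * s i                     ≡⟨ cong (_* s i) (m≡m%n+[m/n]*n V b) ⟨
        V * s i                               ∎)
        where
        open ≡-Reasoning
        q = V / b
        r = V % b
        regroup₁ : ∀ y z a q d → y + z + a * (q + d) ≡ (y + a * d) + (q * a + z)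
        regroup₁ = solve-∀
        regroup₂ : ∀ q x a z → q * x + (q * a + z) ≡ q * (x + a) + z
        regroup₂ = solve-∀
        regroup₃ : ∀ q b x r → q * (b * x) + r * x ≡ (r + q * b) * x
        regroup₃ = solve-∀

    carry : ∀ V {c} → c ≤ L V → ∃[ y ] (y ∈ S × y + a * c ≡ m * V)
    carry V {c} c≤ with y , y∈S , eq ← carry′ (V / b) V 0 c c≤ =
      y , y∈S , trans eq (trans (*-comm V (s 0)) (cong (_* V) s0≡m))

    -- Converse of `carry`: a generator has V = bⁱ and c = L V, and superadditivity of L preserves c
    -- ≤ L V when sums are formed.
    S⇒carry : ∀ {x} → x ∈ S → ∃[ V ] ∃[ c ] (c ≤ L V × x + a * c ≡ m * V)
    S⇒carry (gen (i , refl)) = b ^ i , L (b ^ i) , ≤-refl , (begin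
      s′ b n i + a * L (b ^ i)            ≡⟨ cong (_+ a * L (b ^ i)) (s′≡s i) ⟩
      M * b ^ i + 1 + a * L (b ^ i)       ≡⟨ regroup (M * b ^ i) (a * L (b ^ i)) ⟩
      M * b ^ i + (a * L (b ^ i) + 1)     ≡⟨ cong (M * b ^ i +_) (aL[bⁱ]+1≡bⁱ i) ⟩
      M * b ^ i + b ^ i                   ≡⟨ +-comm (M * b ^ i) (b ^ i) ⟩
      m * b ^ i                           ∎)
      where
      open ≡-Reasoning
      regroup : ∀ x y → x + 1 + y ≡ x + (y + 1)
      regroup = solve-∀
    S⇒carry zero = 0 , 0 , z≤n , trans (*-zeroʳ a) (sym (*-zeroʳ m))
    S⇒carry (plus {x} {y} x∈S y∈S)
      with V , c , c≤ , eq ← S⇒carry x∈S | V′ , c′ , c′≤ , eq′ ← S⇒carry y∈S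
      = V + V′ , c + c′ , ≤-trans (+-mono-≤ c≤ c′≤) (L-superadditive V V′) , (begin
      x + y + a * (c + c′)            ≡⟨ regroup x y a c c′ ⟩
      (x + a * c) + (y + a * c′)      ≡⟨ cong₂ _+_ eq eq′ ⟩
      m * V + m * V′                  ≡⟨ *-distribˡ-+ m V V′ ⟨
      m * (V + V′)                    ∎)
      where
      open ≡-Reasoning
      regroup : ∀ x y a c d → x + y + a * (c + d) ≡ (x + a * c) + (y + a * d)
      regroup = solve-∀

    -- Modulo a, b ≡ 1, so m = (b + 1) bⁿ + 1 ≡ 3.
    m≡3+a* : ∃[ R ] (m ≡ a * R + 3)
    m≡3+a* = 1 + (2 + a) * L (b ^ n) , (begin
      suc ((b + 1) * b ^ n)                   ≡⟨ cong (λ z → suc ((b + 1) * z)) (aL[bⁱ]+1≡bⁱ n) ⟨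
      suc ((b + 1) * (a * L (b ^ n) + 1))     ≡⟨ regroup a (L (b ^ n)) ⟩
      a * (1 + (2 + a) * L (b ^ n)) + 3       ∎)
      where
      open ≡-Reasoning
      regroup : ∀ a x → suc ((suc a + 1) * (a * x + 1)) ≡ a * (1 + (2 + a) * x) + 3
      regroup = solve-∀

    -- By `m≡3+a*` a common divisor of a and m divides 3, and it can be 3 only if 3 divides a = b -
    -- 1.
    coprime-a-m : b % 3 ≢ 1 → Coprime a m
    coprime-a-m b%3≢1 {d} (d∣a , d∣m) with R , m≡ ← m≡3+a*
      with ∣m+n∣m⇒∣n (subst (d ∣_) m≡ d∣m) (∣-trans d∣a (m∣m*n R))
    ... | d∣3 = divisor-of-3 d d∣3 d∣a (∣⇒≤ d∣3)
      where
      divisor-of-3 : ∀ d → d ∣ 3 → d ∣ a → d ≤ 3 → d ≡ 1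
      divisor-of-3 0 d∣3 _ _ with () ← 0∣⇒≡0 d∣3
      divisor-of-3 1 _ _ _ = refl
      divisor-of-3 2 d∣3 _ _ with () ← n∣m⇒m%n≡0 3 2 d∣3
      divisor-of-3 3 _ 3∣a _ = contradiction (%-remove-+ʳ 1 3∣a) b%3≢1
      divisor-of-3 (suc (suc (suc (suc _)))) _ _ (s≤s (s≤s (s≤s ())))

    -- The Apéry set and the genus.

    module Genus (N : ℕ) (M≤F[N] : M ≤ F N) (b%3≢1 : b % 3 ≢ 1) where

      -- N merely bounds the search: for c ≤ M, `W c` is the least W with c ≤ F W. Since L (b W) = F
      -- W, `b * W c` is the least V with c ≤ L V, which makes `w c` the candidate for the least
      -- element in the class of - a c.
      W w : ℕ → ℕ
      W c = #below F N c
      w c = m * (b * W c) ∸ a * c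

      c≤F[W] : ∀ {c} → c < m → c ≤ F (W c)
      c≤F[W] c<m = #below-reaches F-mono N (≤-trans (s≤s⁻¹ c<m) M≤F[N])

      W-least : ∀ {c i} → c ≤ F i → W c ≤ i
      W-least = #below-least F-mono N

      private
        w-carry : ∀ {c} → c < m → ∃[ y ] (y ∈ S × y + a * c ≡ m * (b * W c))
        w-carry {c} c<m = carry (b * W c)
          (≤-trans (c≤F[W] c<m) (≤-reflexive (cong F (sym ([b*x]/b≡x (W c))))))

      w+ac≡ : ∀ {c} → c < m → w c + a * c ≡ m * (b * W c)
      w+ac≡ {c} c<m with y , _ , eq ← w-carry c<m =
        m∸n+n≡m (≤-trans (m≤n+m (a * c) y) (≤-reflexive eq))

      w∈S : ∀ {c} → c < m → w c ∈ S
      w∈S {c} c<m with y , y∈S , eq ← w-carry c<m =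
        subst (_∈ S) (+-cancelʳ-≡ (a * c) y (w c) (trans eq (sym (w+ac≡ c<m)))) y∈S

      W0≡0 : W 0 ≡ 0
      W0≡0 = n≤0⇒n≡0 (W-least z≤n)

      w0≡0 : w 0 ≡ 0
      w0≡0 = trans (cong (_∸ a * 0) m*[b*W0]≡0) (0∸n≡0 (a * 0))
        where
        m*[b*W0]≡0 : m * (b * W 0) ≡ 0
        m*[b*W0]≡0 = trans (cong (m *_) (trans (cong (b *_) W0≡0) (*-zeroʳ b))) (*-zeroʳ m)

      1≤M : 1 ≤ M
      1≤M = >-nonZero⁻¹ M {{m*n≢0 (b + 1) (b ^ n) {{_}} {{m^n≢0 b n}}}}

      -- Passing from c to c + j m costs more than it gains: V must grow by at
      -- least a j, so the minimum over a residue class is attained at c < m.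
      W+j≤ : ∀ {c} j X → c < m → c + j * m ≤ F X → W c + j ≤ X
      W+j≤ {c} zero    X c<m c≤ rewrite +-identityʳ c | +-identityʳ (W c) = W-least c≤
      W+j≤ {c} (suc j) zero c<m c+jm≤ with () ← ≤-trans (m≤n+m _ c) c+jm≤
      W+j≤ {c} (suc i) X@(suc _) c<m c+jm≤ = begin
        -- It is enough that c + j ≤ X: then c ≤ X - j ≤ F (X - j), so W c ≤ X - j.
        W c + j       ≤⟨ +-monoˡ-≤ j (W-least (≤-trans c≤X∸j (x≤Fx (X ∸ j)))) ⟩
        X ∸ j + j     ≡⟨ m∸n+n≡m (m+n≤o⇒n≤o c c+j≤X) ⟩
        X             ∎
        where
        open ≤-Reasoning
        j = suc i
        -- This amounts to (j - 1) (M - 1) ≥ 0.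
        j+M≤ : j + M ≤ j * M + 1
        j+M≤ = product-bound i M 1≤M
          where
          product-bound : ∀ i M → 1 ≤ M → suc i + M ≤ suc i * M + 1
          product-bound i (suc M) _ = ≤-trans (m≤m+n _ (i * M)) (≤-reflexive (regroup i M))
            where
            regroup : ∀ i M → suc i + suc M + i * M ≡ suc i * suc M + 1
            regroup = solve-∀
        -- The chain is b (c + j) ≤ a (c + j m) + 1 ≤ a F X + 1 ≤ b X, where the first link uses c ≤
        -- M and `j+M≤`.
        c+j≤X : c + j ≤ X
        c+j≤X = *-cancelˡ-≤ b (begin
          b * (c + j)                 ≡⟨ regroup₁ a c j ⟩
          a * (c + j) + j + c         ≤⟨ +-monoʳ-≤ (a * (c + j) + j) (s≤s⁻¹ c<m) ⟩
          a * (c + j) + j + M         ≡⟨ +-assoc (a * (c + j)) j M ⟩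
          a * (c + j) + (j + M)       ≤⟨ +-monoʳ-≤ (a * (c + j)) j+M≤ ⟩
          a * (c + j) + (j * M + 1)   ≤⟨ +-monoʳ-≤ (a * (c + j)) (+-monoˡ-≤ 1 (m≤n*m (j * M) a)) ⟩
          a * (c + j) + (a * (j * M) + 1) ≡⟨ regroup₂ a c j M ⟩
          a * (c + j * m) + 1         ≤⟨ +-monoˡ-≤ 1 (*-monoʳ-≤ a c+jm≤) ⟩
          a * F X + 1                 ≤⟨ F-bound z<s ⟩
          b * X                       ∎)
          where
          regroup₁ : ∀ a c j → suc a * (c + j) ≡ a * (c + j) + j + c
          regroup₁ = solve-∀
          regroup₂ : ∀ a c j M → a * (c + j) + (a * (j * M) + 1) ≡ a * (c + j * suc M) + 1
          regroup₂ = solve-∀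
        c≤X∸j : c ≤ X ∸ j
        c≤X∸j = ≤-trans (≤-reflexive (sym (m+n∸n≡m c j))) (∸-monoˡ-≤ j c+j≤X)

      -- The number C of carries is reduced modulo m to C = c + j m. Then x = w c + (V - a j - b W
      -- c) m, and the coefficient is not negative because `W+j≤` gives b (W c + j) ≤ V.
      w-complete : ∀ {x} → x ∈ S → ∃[ c ] ∃[ j ] (c < m × x ≡ w c + j * m)
      w-complete {x} x∈S with V , C , C≤ , eq ← S⇒carry x∈S = c , e , c<m , +-cancelʳ-≡ (a * c + j * a * m) _ _ (begin-equality
        x + (a * c + j * a * m)             ≡⟨ regroup₁ x a c j m ⟩
        x + a * (c + j * m)                 ≡⟨ cong (λ z → x + a * z) C≡ ⟨
        x + a * C                           ≡⟨ eq ⟩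
        m * V                               ≡⟨ cong (m *_) (m+[n∸m]≡n aj+bW≤V) ⟨
        m * (a * j + b * W c + e)           ≡⟨ regroup₂ m a j (b * W c) e ⟩
        m * (b * W c) + (e * m + j * a * m) ≡⟨ cong (_+ (e * m + j * a * m)) (w+ac≡ c<m) ⟨
        w c + a * c + (e * m + j * a * m)   ≡⟨ regroup₃ (w c) (a * c) (e * m) (j * a * m) ⟩
        w c + e * m + (a * c + j * a * m)   ∎)
        where
        open ≤-Reasoning
        c = C % m
        j = C / m
        c<m : c < m
        c<m = m%n<n C m
        C≡ : C ≡ c + j * m
        C≡ = m≡m%n+[m/n]*n C m
        aj+bW≤V : a * j + b * W c ≤ V
        aj+bW≤V = begin
          a * j + b * W c   ≤⟨ +-monoˡ-≤ (b * W c) (*-monoˡ-≤ j (n≤1+n a)) ⟩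
          b * j + b * W c   ≡⟨ regroup b j (W c) ⟩
          (W c + j) * b     ≤⟨ *-monoˡ-≤ b (W+j≤ j (V / b) c<m (≤-trans (≤-reflexive (sym C≡)) C≤)) ⟩
          V / b * b         ≤⟨ m/n*n≤m V b ⟩
          V                 ∎
          where
          regroup : ∀ b j x → b * j + b * x ≡ (x + j) * b
          regroup = solve-∀
        e = V ∸ (a * j + b * W c)
        regroup₁ : ∀ x a c j m → x + (a * c + j * a * m) ≡ x + a * (c + j * m)
        regroup₁ = solve-∀
        regroup₂ : ∀ m a j x e → m * (a * j + x + e) ≡ m * x + (e * m + j * a * m)
        regroup₂ = solve-∀
        regroup₃ : ∀ w x y z → w + x + (y + z) ≡ w + y + (x + z)
        regroup₃ = solve-∀

      private
        inverse : ∃[ v ] (m ∣ a * v + 1)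
        inverse = coprime⇒negative-inverse a m (coprime-a-m b%3≢1)
        open Residues M a (proj₁ inverse) (proj₂ inverse) w (λ c → b * W c) w+ac≡ w0≡0

      g : ℕ
      g = ∑ m (λ c → w c / m)

      genus : HasGenus S g
      genus = genus-of-Apéry m S w w-injective w-surjective
        (λ j c<m → plus (w∈S c<m) (*-closed j m∈S)) w-complete

      2g+bM≡2b∑W : 2 * g + b * M ≡ 2 * (b * ∑ m W)
      2g+bM≡2b∑W = trans 2∑[w/m]+[1+a]M≡2∑V (cong (2 *_) (*-distribˡ-∑ m b W))

      -- Double counting of the pairs (i, c) with i < N and F i < c ≤ M.
      ∑W : ∑ m W ≡ ∑ N (λ i → M ∸ F i)
      ∑W = trans (∑-swap m N _) (∑-cong N (λ {i} _ → ∑-𝟙 M (F i)))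

  -- Evaluation of the genus for n ≥ 2.

  module _ (β k : ℕ) where
    open Semigroup β (2 + k)
    private
      K N : ℕ
      K = A * b ^ suc k
      N = 2 + K

      F[K]+2≡M : F K + 2 ≡ M
      F[K]+2≡M = F[Abᵏ]+2 (suc k)

      -- Because n ≥ 2, K = A bⁿ⁻¹ is still a multiple of b, so passing to K + 1 produces no further
      -- carry.
      F[1+K] : F (suc K) ≡ F K + 1
      F[1+K] = begin
        F (suc K)                     ≡⟨ cong F (+-comm 1 K) ⟩
        F (K + 1)                     ≡⟨ cong (λ z → F (z + 1)) K≡ ⟩
        F (b * (A * b ^ k) + 1)       ≡⟨ F[b*x+1] (A * b ^ k) ⟩
        F (b * (A * b ^ k)) + 1       ≡⟨ cong (λ z → F z + 1) K≡ ⟨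
        F K + 1                       ∎
        where
        open ≡-Reasoning
        swap : ∀ x y z → x * (y * z) ≡ y * (x * z)
        swap = solve-∀
        K≡ : K ≡ b * (A * b ^ k)
        K≡ = swap A b (b ^ k)

      F[1+K]+1≡M : F (suc K) + 1 ≡ M
      F[1+K]+1≡M = trans (cong (_+ 1) F[1+K]) (trans (+-assoc (F K) 1 1) F[K]+2≡M)

      M≤F[N] : M ≤ F N
      M≤F[N] = begin
        M               ≡⟨ F[1+K]+1≡M ⟨
        F (suc K) + F 1 ≤⟨ F-superadditive (suc K) 1 ⟩
        F (suc K + 1)   ≡⟨ cong F (+-comm (suc K) 1) ⟩
        F N             ∎
        where open ≤-Reasoning

      -- This makes the truncated differences `M ∸ F i` in `∑W` exact.
      F≤M : ∀ {i} → i < N → F i ≤ M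
      F≤M i<N = ≤-trans (F-mono (s≤s⁻¹ i<N)) (≤-trans (m≤m+n _ 1) (≤-reflexive F[1+K]+1≡M))

    module _ (b%3≢1 : b % 3 ≢ 1) where
      open Genus N M≤F[N] b%3≢1

      private
        -- In `∑W` the terms at i = K and i = K + 1 are 2 and 1, whence the 3; the terms with i < K
        -- give K M - G K.
        ∑W+G : ∑ m W + G K ≡ K * M + 3
        ∑W+G = +-cancelʳ-≡ (F K + F (suc K)) _ _ (begin
          ∑ m W + G K + (F K + F (suc K))       ≡⟨ regroup₁ (∑ m W) (G K) (F K) (F (suc K)) ⟩
          ∑ m W + ∑ N F                         ≡⟨ cong (_+ ∑ N F) ∑W ⟩
          ∑ N (λ i → M ∸ F i) + ∑ N F           ≡⟨ ∑-distrib-+ N _ F ⟨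
          ∑ N (λ i → M ∸ F i + F i)             ≡⟨ ∑-cong N (λ i<N → m∸n+n≡m (F≤M i<N)) ⟩
          ∑ N (λ _ → M)                         ≡⟨ ∑-const N M ⟩
          N * M                                 ≡⟨ regroup₂ K M ⟩
          K * M + (M + M)                       ≡⟨ cong₂ (λ x y → K * M + (x + y)) F[K]+2≡M F[1+K]+1≡M ⟨
          K * M + (F K + 2 + (F (suc K) + 1))   ≡⟨ regroup₃ (K * M) (F K) (F (suc K)) ⟩
          K * M + 3 + (F K + F (suc K))         ∎)
          where
          open ≡-Reasoning
          regroup₁ : ∀ x g y z → x + g + (y + z) ≡ x + (g + y + z)
          regroup₁ = solve-∀
          regroup₂ : ∀ K M → (2 + K) * M ≡ K * M + (M + M)
          regroup₂ = solve-∀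
          regroup₃ : ∀ x y z → x + (y + 2 + (z + 1)) ≡ x + 3 + (y + z)
          regroup₃ = solve-∀

        -- The correction term of `2G[Abᵏ]` at exponent n - 1, so that K M = 2 G K + E.
        E = (A * suc k + a * (3 * a + 7)) * b ^ suc k

        -- Twice b times ∑ W = K M + 3 - G K, with 2 G K replaced by K M - E.
        2g+bM≡ : 2 * g + b * M ≡ b * (K * M) + 6 * b + b * E
        2g+bM≡ = +-cancelʳ-≡ (b * (2 * G K + E)) _ _ (begin
          2 * g + b * M + b * (2 * G K + E)         ≡⟨ cong (_+ b * (2 * G K + E)) 2g+bM≡2b∑W ⟩
          2 * (b * ∑ m W) + b * (2 * G K + E)       ≡⟨ regroup₁ b (∑ m W) (G K) E ⟩
          2 * b * (∑ m W + G K) + b * E             ≡⟨ cong (λ z → 2 * b * z + b * E) ∑W+G ⟩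
          2 * b * (K * M + 3) + b * E               ≡⟨ regroup₂ b (K * M) E ⟩
          b * (K * M) + 6 * b + b * E + b * (K * M) ≡⟨ cong (λ z → b * (K * M) + 6 * b + b * E + b * z) KM≡ ⟩
          b * (K * M) + 6 * b + b * E + b * (2 * G K + E) ∎)
          where
          open ≡-Reasoning
          regroup₁ : ∀ b x g e → 2 * (b * x) + b * (2 * g + e) ≡ 2 * b * (x + g) + b * e
          regroup₁ = solve-∀
          regroup₂ : ∀ b x e → 2 * b * (x + 3) + b * e ≡ b * x + 6 * b + b * e + b * x
          regroup₂ = solve-∀
          regroup₃ : ∀ A b P → A * P * ((b + 1) * (b * P)) ≡ A * (b + 1) * b * (P * P)
          regroup₃ = solve-∀
          KM≡ : K * M ≡ 2 * G K + E
          KM≡ = trans (regroup₃ A b (b ^ suc k)) (sym (2G[Abᵏ] (suc k)))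

      genus-formula : DoubledFormula g b (2 + k)
      genus-formula = +-cancelʳ-≡ (b * M) _ _ (begin
        2 * g + X + b * M                         ≡⟨ swap (2 * g) X (b * M) ⟩
        2 * g + b * M + X                         ≡⟨ cong (_+ X) 2g+bM≡ ⟩
        b * (K * M) + 6 * b + b * E + X           ≡⟨ identity a k (b ^ suc k) ⟩
        6 * b + Y + b * M                         ∎)
        where
        open ≡-Reasoning
        n = 2 + k
        B = b ^ n
        X = B * B * (b + 1) + B * (n + 3)
        Y = B * B * (b ^ 3 + b ^ 2) + B * (b ^ 2 * (n + 1))
        swap : ∀ x y z → x + y + z ≡ x + z + y
        swap = solve-∀
        -- Here P = bⁿ⁻¹, and b³ and b² are unfolded, so that both sides are polynomials in a, k and
        -- P.
        identity : ∀ a k P → let b = suc a; B = b * P; A = a * (2 + a); M = (b + 1) * B; n = 2 + k in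
          b * (A * P * M) + 6 * b + b * ((A * suc k + a * (3 * a + 7)) * P) + (B * B * (b + 1) + B * (n + 3))
          ≡ 6 * b + (B * B * (b * (b * (b * 1)) + b * (b * 1)) + B * (b * (b * 1) * (n + 1))) + b * M
        identity = solve-∀

      genus-with-formula : ∃[ g ] (HasGenus (T′ b (2 + k)) g × DoubledFormula g b (2 + k))
      genus-with-formula = g , genus , genus-formula

  genus-of-T′ : ∀ b n → 2 ≤ b → b % 3 ≢ 1 → 2 ≤ n →
                ∃[ g ] (HasGenus (T′ b n) g × DoubledFormula g b n)
  genus-of-T′ (suc (suc β)) (suc (suc k)) (s≤s (s≤s _)) b%3≢1 (s≤s (s≤s _)) = genus-with-formula β k b%3≢1

open Naturals using (genus-of-T′)

-- Passage from the doubled formula in ℕ to the quotient in ℚ.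

open import Data.Integer.Base as ℤ using (ℤ; +_)
open import Data.Rational.Base as ℚ using (ℚ; _/_)
import Data.Integer.Properties as ℤ
import Data.Integer.Tactic.RingSolver as ℤ
import Data.Nat.Properties as ℕ
import Data.Rational.Properties as ℚ
open import Data.Rational.Unnormalised.Base as ℚᵘ using (mkℚᵘ; *≡*)
import Data.Rational.Unnormalised.Properties as ℚᵘ

pos-^ : ∀ x n → (+ x) ℤ.^ n ≡ + (x ℕ.^ n)
pos-^ x ℕ.zero    = refl
pos-^ x (ℕ.suc n) = trans (cong (+ x ℤ.*_) (pos-^ x n)) (sym (ℤ.pos-* x (x ℕ.^ n)))

-- The comparison takes place among unnormalised fractions, where equality is cross multiplication
-- and no reduction to lowest terms intervenes.
halves : ∀ g x z → + 2 ℤ.* g ≡ + 2 ℤ.* x ℤ.+ z → g / 1 ≡ x / 1 ℚ.+ z / 2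
halves g x z eq = ℚ.toℚᵘ-injective (begin-equality
  ℚ.toℚᵘ (g / 1)                        ≃⟨ ℚ.toℚᵘ-fromℚᵘ (mkℚᵘ g 0) ⟩
  mkℚᵘ g 0                              ≃⟨ *≡* cross ⟩
  mkℚᵘ x 0 ℚᵘ.+ mkℚᵘ z 1                ≃⟨ ℚᵘ.+-cong (ℚ.toℚᵘ-fromℚᵘ (mkℚᵘ x 0)) (ℚ.toℚᵘ-fromℚᵘ (mkℚᵘ z 1)) ⟨
  ℚ.toℚᵘ (x / 1) ℚᵘ.+ ℚ.toℚᵘ (z / 2)    ≃⟨ ℚ.toℚᵘ-homo-+ (x / 1) (z / 2) ⟨
  ℚ.toℚᵘ (x / 1 ℚ.+ z / 2)              ∎)
  where
  open ℚᵘ.≤-Reasoning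
  cross : g ℤ.* + 2 ≡ (x ℤ.* + 2 ℤ.+ z ℤ.* + 1) ℤ.* + 1
  cross = trans (ℤ.*-comm g (+ 2)) (trans eq (regroup x z))
    where
    regroup : ∀ x z → + 2 ℤ.* x ℤ.+ z ≡ (x ℤ.* + 2 ℤ.+ z ℤ.* + 1) ℤ.* + 1
    regroup = ℤ.solve-∀

-- Subtraction is restored here: X collects the terms that the doubled formula keeps on the left,
-- and it is subtracted from both sides after the cast to ℤ.
formula-in-ℤ : ∀ g b n → DoubledFormula g b n →
  + 2 ℤ.* + g ≡ + 2 ℤ.* (+ 3 ℤ.* + b) ℤ.+
    (((+ b) ℤ.^ (2 ℕ.* n)) ℤ.* ((+ b) ℤ.^ 3 ℤ.+ (+ b) ℤ.^ 2 ℤ.- + b ℤ.- + 1)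
      ℤ.+ ((+ b) ℤ.^ n) ℤ.* ((+ b) ℤ.^ 2 ℤ.* (+ n ℤ.+ + 1) ℤ.- (+ n ℤ.+ + 3)))
formula-in-ℤ g b n eq = begin
  + 2 ℤ.* + g
    ≡⟨ add-sub (+ 2 ℤ.* + g) X ⟩
  + 2 ℤ.* + g ℤ.+ X ℤ.- X
    ≡⟨ cong (ℤ._- X) cast ⟩
  + 6 ℤ.* + b ℤ.+ Y ℤ.- X
    ≡⟨ regroup (+ b) (+ B) (+ n) ⟩
  + 2 ℤ.* (+ 3 ℤ.* + b) ℤ.+ (+ B ℤ.* + B ℤ.* D ℤ.+ + B ℤ.* D′)
    ≡⟨ cong₂ (λ x y → + 2 ℤ.* (+ 3 ℤ.* + b) ℤ.+ (x ℤ.* D ℤ.+ y ℤ.* D′)) b^2n (pos-^ b n) ⟨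
  + 2 ℤ.* (+ 3 ℤ.* + b) ℤ.+ (((+ b) ℤ.^ (2 ℕ.* n)) ℤ.* D ℤ.+ ((+ b) ℤ.^ n) ℤ.* D′) ∎
  where
  open ≡-Reasoning
  B = b ℕ.^ n
  D = (+ b) ℤ.^ 3 ℤ.+ (+ b) ℤ.^ 2 ℤ.- + b ℤ.- + 1
  D′ = (+ b) ℤ.^ 2 ℤ.* (+ n ℤ.+ + 1) ℤ.- (+ n ℤ.+ + 3)
  X = + B ℤ.* + B ℤ.* (+ b ℤ.+ + 1) ℤ.+ + B ℤ.* (+ n ℤ.+ + 3)
  Y = + B ℤ.* + B ℤ.* ((+ b) ℤ.^ 3 ℤ.+ (+ b) ℤ.^ 2) ℤ.+ + B ℤ.* ((+ b) ℤ.^ 2 ℤ.* (+ n ℤ.+ + 1))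
  add-sub : ∀ x y → x ≡ x ℤ.+ y ℤ.- y
  add-sub = ℤ.solve-∀
  regroup : ∀ b B n →
    + 6 ℤ.* b ℤ.+ (B ℤ.* B ℤ.* (b ℤ.* (b ℤ.* (b ℤ.* + 1)) ℤ.+ b ℤ.* (b ℤ.* + 1)) ℤ.+ B ℤ.* (b ℤ.* (b ℤ.* + 1) ℤ.* (n ℤ.+ + 1)))
      ℤ.- (B ℤ.* B ℤ.* (b ℤ.+ + 1) ℤ.+ B ℤ.* (n ℤ.+ + 3))
    ≡ + 2 ℤ.* (+ 3 ℤ.* b) ℤ.+ (B ℤ.* B ℤ.* (b ℤ.* (b ℤ.* (b ℤ.* + 1)) ℤ.+ b ℤ.* (b ℤ.* + 1) ℤ.- b ℤ.- + 1)
      ℤ.+ B ℤ.* (b ℤ.* (b ℤ.* + 1) ℤ.* (n ℤ.+ + 1) ℤ.- (n ℤ.+ + 3)))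
  regroup = ℤ.solve-∀
  b^2n : (+ b) ℤ.^ (2 ℕ.* n) ≡ + B ℤ.* + B
  b^2n = begin
    (+ b) ℤ.^ (2 ℕ.* n)            ≡⟨ cong (λ z → (+ b) ℤ.^ (n ℕ.+ z)) (ℕ.+-identityʳ n) ⟩
    (+ b) ℤ.^ (n ℕ.+ n)            ≡⟨ ℤ.^-distribˡ-+-* (+ b) n n ⟩
    (+ b) ℤ.^ n ℤ.* (+ b) ℤ.^ n    ≡⟨ cong₂ ℤ._*_ (pos-^ b n) (pos-^ b n) ⟩
    + B ℤ.* + B                    ∎
  BB* : ∀ x {y} → + x ≡ y → + (B ℕ.* B ℕ.* x) ≡ + B ℤ.* + B ℤ.* y
  BB* x refl = trans (ℤ.pos-* (B ℕ.* B) x) (cong (ℤ._* + x) (ℤ.pos-* B B))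
  B* : ∀ x {y} → + x ≡ y → + (B ℕ.* x) ≡ + B ℤ.* y
  B* x refl = ℤ.pos-* B x
  X-cast : + (B ℕ.* B ℕ.* (b ℕ.+ 1) ℕ.+ B ℕ.* (n ℕ.+ 3)) ≡ X
  X-cast = cong₂ ℤ._+_ (BB* (b ℕ.+ 1) refl) (B* (n ℕ.+ 3) refl)
  Y-cast : + (B ℕ.* B ℕ.* (b ℕ.^ 3 ℕ.+ b ℕ.^ 2) ℕ.+ B ℕ.* (b ℕ.^ 2 ℕ.* (n ℕ.+ 1))) ≡ Y
  Y-cast = cong₂ ℤ._+_
    (BB* (b ℕ.^ 3 ℕ.+ b ℕ.^ 2) (cong₂ ℤ._+_ (sym (pos-^ b 3)) (sym (pos-^ b 2))))
    (B* (b ℕ.^ 2 ℕ.* (n ℕ.+ 1)) (trans (ℤ.pos-* (b ℕ.^ 2) (n ℕ.+ 1)) (cong (ℤ._* (+ n ℤ.+ + 1)) (sym (pos-^ b 2)))))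
  cast : + 2 ℤ.* + g ℤ.+ X ≡ + 6 ℤ.* + b ℤ.+ Y
  cast = begin
    + 2 ℤ.* + g ℤ.+ X    ≡⟨ cong₂ ℤ._+_ (ℤ.pos-* 2 g) X-cast ⟨
    + (2 ℕ.* g ℕ.+ _)    ≡⟨ cong +_ eq ⟩
    + (6 ℕ.* b ℕ.+ _)    ≡⟨ cong₂ ℤ._+_ (ℤ.pos-* 6 b) Y-cast ⟩
    + 6 ℤ.* + b ℤ.+ Y    ∎

formula-in-ℚ : ∀ g b n → DoubledFormula g b n →
  + g / 1 ≡ (+ 3 ℤ.* + b) / 1 ℚ.+
    (((+ b) ℤ.^ (2 ℕ.* n)) ℤ.* ((+ b) ℤ.^ 3 ℤ.+ (+ b) ℤ.^ 2 ℤ.- + b ℤ.- + 1)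
      ℤ.+ ((+ b) ℤ.^ n) ℤ.* ((+ b) ℤ.^ 2 ℤ.* (+ n ℤ.+ + 1) ℤ.- (+ n ℤ.+ + 3))) / 2
formula-in-ℚ g b n eq = halves (+ g) (+ 3 ℤ.* + b)
  (((+ b) ℤ.^ (2 ℕ.* n)) ℤ.* ((+ b) ℤ.^ 3 ℤ.+ (+ b) ℤ.^ 2 ℤ.- + b ℤ.- + 1)
    ℤ.+ ((+ b) ℤ.^ n) ℤ.* ((+ b) ℤ.^ 2 ℤ.* (+ n ℤ.+ + 1) ℤ.- (+ n ℤ.+ + 3)))
  (formula-in-ℤ g b n eq)

mainTheorem14 : (b n : ℕ) → 2 ℕ.≤ b → b % 3 ≢ 1 → 2 ℕ.≤ n →
    ∃[ g ] (HasGenus (T′ b n) g ×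
    + g / 1 ≡
    (+ 3 ℤ.* + b) / 1
    ℚ.+ (((+ b) ℤ.^ (2 ℕ.* n)) ℤ.* ((+ b) ℤ.^ 3 ℤ.+ (+ b) ℤ.^ 2 ℤ.- + b ℤ.- + 1)
    ℤ.+ ((+ b) ℤ.^ n) ℤ.* ((+ b) ℤ.^ 2 ℤ.* (+ n ℤ.+ + 1) ℤ.- (+ n ℤ.+ + 3))) / 2)
mainTheorem14 b n 2≤b b%3≢1 2≤n =
  map₂ (λ {g} → map₂ (formula-in-ℚ g b n)) (genus-of-T′ b n 2≤b b%3≢1 2≤n)
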